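{- Let $$(f_1,f_2,f_3,f_4,f_5)=(\mathcal{C}_{12,34,56},\,-\mathcal{C}_{16,23,45},\,\mathcal{C}_{14,26,35},\,-\mathcal{C}_{15,24,36},\,\mathcal{C}_{13,25,46}),$$ polynomials in $\mathbb{C}[x_1,\dots,x_6]$. Then $$5\sigma_1^3-18\sigma_1\sigma_2+27\sigma_3=0$$ in $\mathbb{C}[x_1,\dots,x_6]$, where $\sigma_i=\sigma_i(f_1,f_2,f_3,f_4,f_5)$ is the degree $i$ elementary symmetric function of $f_1,\dots,f_5$.
   Context: For $\{a,b,c,d,e,f\}=\{1,\dots,6\}$, define the polynomial in $\mathbb{C}[x_1,\dots,x_6]$ $$\mathcal{C}_{ab,cd,ef}=\det\begin{bmatrix}1&1&1\\ x_a+x_b & x_c+x_d & x_e+x_f\\ x_ax_b & x_cx_d & x_ex_f\end{bmatrix}.$$ -}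

module Defs where

open import Level using (Level; _⊔_; 0ℓ)
open import Algebra.Bundles using (CommutativeRing; AbelianGroup)
open import Algebra.Structures using (IsCommutativeRing)
import Algebra.Construct.DirectProduct as DirectProduct
import Algebra.Properties.CommutativeSemigroup as CommutativeSemigroupProperties
import Algebra.Properties.Ring as RingProperties
open import Data.Bool.Base using (if_then_else_)
open import Data.Fin.Base using (Fin; zero; suc; punchIn)
open import Data.Fin.Patterns using (0F; 1F; 2F; 3F; 4F; 5F)
open import Data.List.Base using (List; []; _∷_; _++_; map; foldr; cartesianProductWith)
open import Data.Nat.Base as ℕ using (ℕ; zero; suc)
import Data.Nat.Properties as ℕ
open import Data.Product.Base using (_×_; _,_; ∃-syntax)
import Data.Rational.Properties as ℚ
open import Data.Vec.Base as Vec using (Vec; []; _∷_; lookup; zipWith; replicate; _[_]≔_)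
import Data.Vec.Functional as Vector
import Data.Vec.Properties as Vec
open import Function.Base using (_∘_)
open import Relation.Binary.PropositionalEquality as ≡ using (_≡_; refl; cong; cong₂; subst)
open import Relation.Nullary using (yes; no; does; ¬_)
open import Relation.Nullary.Decidable using (dec-true; dec-false)

private variable
  c ℓ : Level

private module RingIdentities (R : CommutativeRing c ℓ) where
  open CommutativeRing R
  open RingProperties ring
    using (⁻¹-anti-homo‿-; \\-leftDividesʳ; //-rightDividesˡ; -‿+-comm; x[y-z]≈xy-xz)
  open CommutativeSemigroupProperties +-commutativeSemigroup using (interchange)

  swap : ∀ p q → - (p - q) ≈ q - p
  swap = ⁻¹-anti-homo‿-

  cancel : ∀ p q → p ≈ (p - q) + q
  cancel p q = sym (//-rightDividesˡ q p)

  telescope : ∀ p q r → p - r ≈ (p - q) + (q - r)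
  telescope p q r =
    trans (+-congˡ (sym (\\-leftDividesʳ q (- r)))) (sym (+-assoc p (- q) (q - r)))

  neg-sub : ∀ p q → - p - - q ≈ - (p - q)
  neg-sub p q = -‿+-comm p (- q)

  sub-add : ∀ a b c d → (a + b) - (c + d) ≈ (a - c) + (b - d)
  sub-add a b c d =
    trans (+-congˡ (sym (-‿+-comm c d))) (interchange a b (- c) (- d))

  sub-mul : ∀ a b c d → a * b - c * d ≈ a * (b - d) + d * (a - c)
  sub-mul a b c d = trans (telescope (a * b) (a * d) (c * d)) (+-cong
    (sym (x[y-z]≈xy-xz a b d))
    (trans (+-cong (*-comm a d) (-‿cong (*-comm c d))) (sym (x[y-z]≈xy-xz d a c))))

module Reals where
  open import Data.Rational.Base
    using (ℚ; 0ℚ; 1ℚ; ½; ∣_∣; _+_; _*_; _-_; -_; 1/_; _<_; _≤_; positive)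

  Sequence : Set
  Sequence = ℕ → ℚ

  infix 4 _∼_

  -- s m - t n becomes arbitrarily small as m and n grow independently.  This
  -- is a partial equivalence: s ∼ s says that s is a Cauchy sequence, and on
  -- Cauchy sequences s ∼ t says that s - t tends to 0.
  _∼_ : Sequence → Sequence → Set
  s ∼ t = ∀ ε → 0ℚ < ε → ∃[ N ] (∀ m n → N ℕ.≤ m → N ℕ.≤ n → ∣ s m - t n ∣ < ε)

  record ℝ : Set where
    constructor real
    field
      seq    : Sequence
      cauchy : seq ∼ seq

  open ℝ public

  infix 4 _≈_

  _≈_ : ℝ → ℝ → Set
  x ≈ y = seq x ∼ seq y

  private
    module ℚ-ring = RingIdentities ℚ.+-*-commutativeRing

    variable
      s t u v : Sequence

    ∣-∣-swap : ∀ p q → ∣ p - q ∣ ≡ ∣ q - p ∣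
    ∣-∣-swap p q = ≡.trans (≡.sym (ℚ.∣-p∣≡∣p∣ (p - q))) (cong ∣_∣ (ℚ-ring.swap p q))

    halve : ∀ {ε} → 0ℚ < ε → 0ℚ < ½ * ε
    halve {ε} 0<ε = subst (_< ½ * ε) (ℚ.*-zeroʳ ½) (ℚ.*-monoʳ-<-pos ½ 0<ε)

    halves : ∀ ε → ½ * ε + ½ * ε ≡ ε
    halves ε = ≡.trans (≡.sym (ℚ.*-distribʳ-+ ε ½ ½)) (ℚ.*-identityˡ ε)

    ∼-sym : s ∼ t → t ∼ s
    ∼-sym {s} {t} s∼t ε 0<ε with N , h ← s∼t ε 0<ε =
      N , λ m n N≤m N≤n → subst (_< ε) (∣-∣-swap (s n) (t m)) (h n m N≤n N≤m)

    ∼-trans : s ∼ t → t ∼ u → s ∼ u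
    ∼-trans {s} {t} {u} s∼t t∼u ε 0<ε
      with N , h ← s∼t (½ * ε) (halve 0<ε) | M , k ← t∼u (½ * ε) (halve 0<ε) =
      N ℕ.⊔ M , λ m n N⊔M≤m N⊔M≤n →
        let N≤m = ℕ.≤-trans (ℕ.m≤m⊔n N M) N⊔M≤m
            M≤m = ℕ.≤-trans (ℕ.m≤n⊔m N M) N⊔M≤m
            M≤n = ℕ.≤-trans (ℕ.m≤n⊔m N M) N⊔M≤n
        in begin-strict
          ∣ s m - u n ∣                  ≡⟨ cong ∣_∣ (ℚ-ring.telescope (s m) (t m) (u n)) ⟩
          ∣ (s m - t m) + (t m - u n) ∣  ≤⟨ ℚ.∣p+q∣≤∣p∣+∣q∣ (s m - t m) (t m - u n) ⟩
          ∣ s m - t m ∣ + ∣ t m - u n ∣  <⟨ ℚ.+-mono-< (h m m N≤m N≤m) (k m n M≤m M≤n) ⟩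
          ½ * ε + ½ * ε                  ≡⟨ halves ε ⟩
          ε                              ∎
      where open ℚ.≤-Reasoning

    ∼-cong : (∀ n → t n ≡ u n) → s ∼ t → s ∼ u
    ∼-cong {s = s} t≗u s∼t ε 0<ε with N , h ← s∼t ε 0<ε =
      N , λ m n N≤m N≤n → subst (λ q → ∣ s m - q ∣ < ε) (t≗u n) (h m n N≤m N≤n)

    +-∼ : s ∼ t → u ∼ v → (λ n → s n + u n) ∼ (λ n → t n + v n)
    +-∼ {s} {t} {u} {v} s∼t u∼v ε 0<ε
      with N , h ← s∼t (½ * ε) (halve 0<ε) | M , k ← u∼v (½ * ε) (halve 0<ε) =
      N ℕ.⊔ M , λ m n N⊔M≤m N⊔M≤n →
        let N≤m = ℕ.≤-trans (ℕ.m≤m⊔n N M) N⊔M≤m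
            N≤n = ℕ.≤-trans (ℕ.m≤m⊔n N M) N⊔M≤n
            M≤m = ℕ.≤-trans (ℕ.m≤n⊔m N M) N⊔M≤m
            M≤n = ℕ.≤-trans (ℕ.m≤n⊔m N M) N⊔M≤n
        in begin-strict
          ∣ (s m + u m) - (t n + v n) ∣  ≡⟨ cong ∣_∣ (ℚ-ring.sub-add (s m) (u m) (t n) (v n)) ⟩
          ∣ (s m - t n) + (u m - v n) ∣  ≤⟨ ℚ.∣p+q∣≤∣p∣+∣q∣ (s m - t n) (u m - v n) ⟩
          ∣ s m - t n ∣ + ∣ u m - v n ∣  <⟨ ℚ.+-mono-< (h m n N≤m N≤n) (k m n M≤m M≤n) ⟩
          ½ * ε + ½ * ε                  ≡⟨ halves ε ⟩
          ε                              ∎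
      where open ℚ.≤-Reasoning

    -‿∼ : s ∼ t → (λ n → - s n) ∼ (λ n → - t n)
    -‿∼ {s} {t} s∼t ε 0<ε with N , h ← s∼t ε 0<ε =
      N , λ m n N≤m N≤n →
        subst (_< ε) (≡.sym (≡.trans (cong ∣_∣ (ℚ-ring.neg-sub (s m) (t n))) (ℚ.∣-p∣≡∣p∣ (s m - t n))))
          (h m n N≤m N≤n)

    bounded : s ∼ t → ∃[ B ] (0ℚ < B × ∃[ N ] (∀ m → N ℕ.≤ m → ∣ s m ∣ ≤ B))
    bounded {s} {t} s∼t with N , h ← s∼t 1ℚ (ℚ.positive⁻¹ 1ℚ) =
      1ℚ + ∣ t N ∣ , ℚ.+-mono-<-≤ (ℚ.positive⁻¹ 1ℚ) (ℚ.0≤∣p∣ (t N)) , N , λ m N≤m → begin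
        ∣ s m ∣                    ≡⟨ cong ∣_∣ (ℚ-ring.cancel (s m) (t N)) ⟩
        ∣ (s m - t N) + t N ∣      ≤⟨ ℚ.∣p+q∣≤∣p∣+∣q∣ (s m - t N) (t N) ⟩
        ∣ s m - t N ∣ + ∣ t N ∣    ≤⟨ ℚ.+-monoˡ-≤ ∣ t N ∣ (ℚ.<⇒≤ (h m N N≤m ℕ.≤-refl)) ⟩
        1ℚ + ∣ t N ∣               ∎
      where open ℚ.≤-Reasoning

    scale : ∀ B → 0ℚ < B → ∀ ε → 0ℚ < ε → ∃[ δ ] (0ℚ < δ × B * δ ≡ ε)
    scale B 0<B ε 0<ε = 1/ B * ε , 0<δ , B*δ≡ε
      where
      instance
        B⁺ = positive 0<B
        B≢0 = ℚ.pos⇒nonZero B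
        B⁻¹⁺ = ℚ.1/pos⇒pos B
      0<δ : 0ℚ < 1/ B * ε
      0<δ = subst (_< 1/ B * ε) (ℚ.*-zeroʳ (1/ B)) (ℚ.*-monoʳ-<-pos (1/ B) 0<ε)
      B*δ≡ε : B * (1/ B * ε) ≡ ε
      B*δ≡ε = ≡.trans (≡.sym (ℚ.*-assoc B (1/ B) ε))
                (≡.trans (cong (_* ε) (ℚ.*-inverseʳ B)) (ℚ.*-identityˡ ε))

    *-bound : ∀ p q {B δ} → 0ℚ < B → ∣ p ∣ ≤ B → ∣ q ∣ < δ → ∣ p * q ∣ < B * δ
    *-bound p q {B} {δ} 0<B ∣p∣≤B ∣q∣<δ = begin-strict
      ∣ p * q ∣      ≡⟨ ℚ.∣p*q∣≡∣p∣*∣q∣ p q ⟩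
      ∣ p ∣ * ∣ q ∣  ≤⟨ ℚ.*-monoʳ-≤-nonNeg ∣ q ∣ {{ℚ.∣-∣-nonNeg q}} ∣p∣≤B ⟩
      B * ∣ q ∣      <⟨ ℚ.*-monoʳ-<-pos B {{positive 0<B}} ∣q∣<δ ⟩
      B * δ          ∎
      where open ℚ.≤-Reasoning

    *-∼ : s ∼ t → u ∼ v → (λ n → s n * u n) ∼ (λ n → t n * v n)
    *-∼ {s} {t} {u} {v} s∼t u∼v ε 0<ε
      with A , 0<A , K , ∣s∣≤A ← bounded {s} {t} s∼t
         | B , 0<B , L , ∣v∣≤B ← bounded {v} {u} (∼-sym {u} {v} u∼v)
      with α , 0<α , A*α≡ε/2 ← scale A 0<A (½ * ε) (halve 0<ε)
         | β , 0<β , B*β≡ε/2 ← scale B 0<B (½ * ε) (halve 0<ε)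
      with M , h ← u∼v α 0<α | N , k ← s∼t β 0<β =
      (K ℕ.⊔ L) ℕ.⊔ (M ℕ.⊔ N) , λ m n ≤m ≤n →
        let K≤m = ℕ.≤-trans (ℕ.≤-trans (ℕ.m≤m⊔n K L) (ℕ.m≤m⊔n _ (M ℕ.⊔ N))) ≤m
            L≤n = ℕ.≤-trans (ℕ.≤-trans (ℕ.m≤n⊔m K L) (ℕ.m≤m⊔n _ (M ℕ.⊔ N))) ≤n
            M≤  = ℕ.≤-trans (ℕ.m≤m⊔n M N) (ℕ.m≤n⊔m (K ℕ.⊔ L) (M ℕ.⊔ N))
            N≤  = ℕ.≤-trans (ℕ.m≤n⊔m M N) (ℕ.m≤n⊔m (K ℕ.⊔ L) (M ℕ.⊔ N))
        in begin-strict
          ∣ s m * u m - t n * v n ∣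
            ≡⟨ cong ∣_∣ (ℚ-ring.sub-mul (s m) (u m) (t n) (v n)) ⟩
          ∣ s m * (u m - v n) + v n * (s m - t n) ∣
            ≤⟨ ℚ.∣p+q∣≤∣p∣+∣q∣ (s m * (u m - v n)) (v n * (s m - t n)) ⟩
          ∣ s m * (u m - v n) ∣ + ∣ v n * (s m - t n) ∣
            <⟨ ℚ.+-mono-<
                 (*-bound (s m) (u m - v n) 0<A (∣s∣≤A m K≤m) (h m n (ℕ.≤-trans M≤ ≤m) (ℕ.≤-trans M≤ ≤n)))
                 (*-bound (v n) (s m - t n) 0<B (∣v∣≤B n L≤n) (k m n (ℕ.≤-trans N≤ ≤m) (ℕ.≤-trans N≤ ≤n))) ⟩
          A * α + B * β
            ≡⟨ cong₂ _+_ A*α≡ε/2 B*β≡ε/2 ⟩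
          ½ * ε + ½ * ε
            ≡⟨ halves ε ⟩
          ε ∎
      where open ℚ.≤-Reasoning

    const-∼ : ∀ q → (λ _ → q) ∼ (λ _ → q)
    const-∼ q ε 0<ε = 0 , λ _ _ _ _ → subst (_< ε) (≡.sym (cong ∣_∣ (ℚ.+-inverseʳ q))) 0<ε

  fromℚ : ℚ → ℝ
  fromℚ q = real (λ _ → q) (const-∼ q)

  infixl 6 _+ᴿ_
  infixl 7 _*ᴿ_
  infix  8 -ᴿ_

  _+ᴿ_ _*ᴿ_ : ℝ → ℝ → ℝ
  x +ᴿ y = real (λ n → seq x n + seq y n) (+-∼ {seq x} {seq x} {seq y} {seq y} (cauchy x) (cauchy y))
  x *ᴿ y = real (λ n → seq x n * seq y n) (*-∼ {seq x} {seq x} {seq y} {seq y} (cauchy x) (cauchy y))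

  -ᴿ_ : ℝ → ℝ
  -ᴿ x = real (λ n → - seq x n) (-‿∼ {seq x} {seq x} (cauchy x))

  private
    pointwise : ∀ x y → (∀ n → seq x n ≡ seq y n) → x ≈ y
    pointwise x y eq = ∼-cong {s = seq x} eq (cauchy x)

    isCommutativeRing : IsCommutativeRing _≈_ _+ᴿ_ _*ᴿ_ -ᴿ_ (fromℚ 0ℚ) (fromℚ 1ℚ)
    isCommutativeRing = record
      { isRing = record
        { +-isAbelianGroup = record
          { isGroup = record
            { isMonoid = record
              { isSemigroup = record
                { isMagma = record
                  { isEquivalence = record
                    { refl  = λ {x} → cauchy x
                    ; sym   = λ {x} {y} → ∼-sym {seq x} {seq y}
                    ; trans = λ {x} {y} {z} → ∼-trans {seq x} {seq y} {seq z}
                    }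
                  ; ∙-cong = λ {x} {y} {u} {v} → +-∼ {seq x} {seq y} {seq u} {seq v}
                  }
                ; assoc = λ x y z → pointwise (x +ᴿ y +ᴿ z) (x +ᴿ (y +ᴿ z))
                    (λ n → ℚ.+-assoc (seq x n) (seq y n) (seq z n))
                }
              ; identity =
                  (λ x → pointwise (fromℚ 0ℚ +ᴿ x) x (λ n → ℚ.+-identityˡ (seq x n))) ,
                  (λ x → pointwise (x +ᴿ fromℚ 0ℚ) x (λ n → ℚ.+-identityʳ (seq x n)))
              }
            ; inverse =
                (λ x → pointwise (-ᴿ x +ᴿ x) (fromℚ 0ℚ) (λ n → ℚ.+-inverseˡ (seq x n))) ,
                (λ x → pointwise (x +ᴿ -ᴿ x) (fromℚ 0ℚ) (λ n → ℚ.+-inverseʳ (seq x n)))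
            ; ⁻¹-cong = λ {x} {y} → -‿∼ {seq x} {seq y}
            }
          ; comm = λ x y → pointwise (x +ᴿ y) (y +ᴿ x) (λ n → ℚ.+-comm (seq x n) (seq y n))
          }
        ; *-cong = λ {x} {y} {u} {v} → *-∼ {seq x} {seq y} {seq u} {seq v}
        ; *-assoc = λ x y z → pointwise (x *ᴿ y *ᴿ z) (x *ᴿ (y *ᴿ z))
            (λ n → ℚ.*-assoc (seq x n) (seq y n) (seq z n))
        ; *-identity =
            (λ x → pointwise (fromℚ 1ℚ *ᴿ x) x (λ n → ℚ.*-identityˡ (seq x n))) ,
            (λ x → pointwise (x *ᴿ fromℚ 1ℚ) x (λ n → ℚ.*-identityʳ (seq x n)))
        ; distrib =
            (λ x y z → pointwise (x *ᴿ (y +ᴿ z)) (x *ᴿ y +ᴿ x *ᴿ z)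
              (λ n → ℚ.*-distribˡ-+ (seq x n) (seq y n) (seq z n))) ,
            (λ x y z → pointwise ((y +ᴿ z) *ᴿ x) (y *ᴿ x +ᴿ z *ᴿ x)
              (λ n → ℚ.*-distribʳ-+ (seq x n) (seq y n) (seq z n)))
        }
      ; *-comm = λ x y → pointwise (x *ᴿ y) (y *ᴿ x) (λ n → ℚ.*-comm (seq x n) (seq y n))
      }

  ℝ-commutativeRing : CommutativeRing 0ℓ 0ℓ
  ℝ-commutativeRing = record { isCommutativeRing = isCommutativeRing }

-- R[i] with i² = -1; the pair (a , b) stands for a + b i.
module AdjoinI (R : CommutativeRing c ℓ) where
  open CommutativeRing R hiding (_≈_)

  private
    module R² = AbelianGroup (DirectProduct.abelianGroup +-abelianGroup +-abelianGroup)
    module R = CommutativeRing R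
    open RingIdentities R using (sub-add)
    open RingProperties ring using (-0#≈0#; -‿+-comm; x[y-z]≈xy-xz; [y-z]x≈yx-zx)
    open CommutativeSemigroupProperties +-commutativeSemigroup using (interchange)

  infixl 7 _*ᵢ_

  _*ᵢ_ : R².Carrier → R².Carrier → R².Carrier
  (a , b) *ᵢ (c , d) = a * c - b * d , a * d + b * c

  private
    *ᵢ-cong : ∀ {x y u v} → x R².≈ y → u R².≈ v → x *ᵢ u R².≈ y *ᵢ v
    *ᵢ-cong (p , q) (r , s) =
      +-cong (*-cong p r) (-‿cong (*-cong q s)) , +-cong (*-cong p s) (*-cong q r)

    *ᵢ-assoc : ∀ x y z → (x *ᵢ y) *ᵢ z R².≈ x *ᵢ (y *ᵢ z)
    *ᵢ-assoc (a , b) (c , d) (e , f) = re , im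
      where
      open import Relation.Binary.Reasoning.Setoid setoid
      re : (a * c - b * d) * e - (a * d + b * c) * f
             R.≈ a * (c * e - d * f) - b * (c * f + d * e)
      re = begin
        (a * c - b * d) * e - (a * d + b * c) * f
          ≈⟨ +-cong ([y-z]x≈yx-zx e (a * c) (b * d)) (-‿cong (distribʳ f (a * d) (b * c))) ⟩
        (a * c * e - b * d * e) - (a * d * f + b * c * f)
          ≈⟨ +-congˡ (sym (-‿+-comm (a * d * f) (b * c * f))) ⟩
        (a * c * e - b * d * e) + (- (a * d * f) - b * c * f)
          ≈⟨ interchange _ _ _ _ ⟩
        (a * c * e - a * d * f) + (- (b * d * e) - b * c * f)
          ≈⟨ +-congˡ (trans (+-comm _ _) (-‿+-comm (b * c * f) (b * d * e))) ⟩
        (a * c * e - a * d * f) - (b * c * f + b * d * e)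
          ≈⟨ +-cong (+-cong (*-assoc a c e) (-‿cong (*-assoc a d f)))
                    (-‿cong (+-cong (*-assoc b c f) (*-assoc b d e))) ⟩
        (a * (c * e) - a * (d * f)) - (b * (c * f) + b * (d * e))
          ≈⟨ +-cong (sym (x[y-z]≈xy-xz a (c * e) (d * f))) (-‿cong (sym (distribˡ b (c * f) (d * e)))) ⟩
        a * (c * e - d * f) - b * (c * f + d * e) ∎
      im : (a * c - b * d) * f + (a * d + b * c) * e
             R.≈ a * (c * f + d * e) + b * (c * e - d * f)
      im = begin
        (a * c - b * d) * f + (a * d + b * c) * e
          ≈⟨ +-cong ([y-z]x≈yx-zx f (a * c) (b * d)) (distribʳ e (a * d) (b * c)) ⟩
        (a * c * f - b * d * f) + (a * d * e + b * c * e)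
          ≈⟨ interchange _ _ _ _ ⟩
        (a * c * f + a * d * e) + (- (b * d * f) + b * c * e)
          ≈⟨ +-congˡ (+-comm _ _) ⟩
        (a * c * f + a * d * e) + (b * c * e - b * d * f)
          ≈⟨ +-cong (+-cong (*-assoc a c f) (*-assoc a d e))
                    (+-cong (*-assoc b c e) (-‿cong (*-assoc b d f))) ⟩
        (a * (c * f) + a * (d * e)) + (b * (c * e) - b * (d * f))
          ≈⟨ +-cong (sym (distribˡ a (c * f) (d * e))) (sym (x[y-z]≈xy-xz b (c * e) (d * f))) ⟩
        a * (c * f + d * e) + b * (c * e - d * f) ∎

    *ᵢ-comm : ∀ x y → x *ᵢ y R².≈ y *ᵢ x
    *ᵢ-comm (a , b) (c , d) =
      +-cong (*-comm a c) (-‿cong (*-comm b d)) ,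
      trans (+-comm (a * d) (b * c)) (+-cong (*-comm b c) (*-comm a d))

    *ᵢ-identityˡ : ∀ x → (1# , 0#) *ᵢ x R².≈ x
    *ᵢ-identityˡ (a , b) =
      trans (+-cong (*-identityˡ a) (trans (-‿cong (zeroˡ b)) -0#≈0#)) (+-identityʳ a) ,
      trans (+-cong (*-identityˡ b) (zeroˡ a)) (+-identityʳ b)

    *ᵢ-distribˡ : ∀ x y z → x *ᵢ (y R².∙ z) R².≈ (x *ᵢ y) R².∙ (x *ᵢ z)
    *ᵢ-distribˡ (a , b) (c , d) (e , f) =
      trans (+-cong (distribˡ a c e) (-‿cong (distribˡ b d f)))
        (sub-add (a * c) (a * e) (b * d) (b * f)) ,
      trans (+-cong (distribˡ a d f) (distribˡ b c e)) (interchange _ _ _ _)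

  commutativeRing : CommutativeRing c ℓ
  commutativeRing = record
    { _*_ = _*ᵢ_
    ; 1#  = 1# , 0#
    ; isCommutativeRing = record
      { isRing = record
        { +-isAbelianGroup = R².isAbelianGroup
        ; *-cong = *ᵢ-cong
        ; *-assoc = *ᵢ-assoc
        ; *-identity = *ᵢ-identityˡ ,
            λ x → R².trans (*ᵢ-comm x (1# , 0#)) (*ᵢ-identityˡ x)
        ; distrib = *ᵢ-distribˡ ,
            λ x y z → R².trans (*ᵢ-comm (y R².∙ z) x)
              (R².trans (*ᵢ-distribˡ x y z) (R².∙-cong (*ᵢ-comm x y) (*ᵢ-comm x z)))
        }
      ; *-comm = *ᵢ-comm
      }
    }

ℂ : CommutativeRing 0ℓ 0ℓ
ℂ = AdjoinI.commutativeRing Reals.ℝ-commutativeRing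

module MultivariatePolynomial (R : CommutativeRing c ℓ) (n : ℕ) where
  private module R = CommutativeRing R
  open R using (Carrier; 0#; 1#)

  -- (m₁ , … , mₙ) stands for x₁^m₁ ⋯ xₙ^mₙ.
  Monomial : Set
  Monomial = Vec ℕ n

  infixl 7 _·_

  _·_ : Monomial → Monomial → Monomial
  _·_ = zipWith ℕ._+_

  -- A formal sum of terms; monomials may be repeated and coefficients may be
  -- zero, so polynomials are compared by their coefficients.
  Polynomial : Set c
  Polynomial = List (Carrier × Monomial)

  -- The R-linear extension of a function on monomials.
  linear : (Monomial → Carrier) → Polynomial → Carrier
  linear φ = foldr (λ (a , u) → (a R.* φ u) R.+_) 0#

  δ : Monomial → Monomial → Carrier
  δ m u = if does (Vec.≡-dec ℕ._≟_ u m) then 1# else 0#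

  coefficient : Monomial → Polynomial → Carrier
  coefficient m = linear (δ m)

  infix 4 _≈_

  _≈_ : Polynomial → Polynomial → Set ℓ
  p ≈ q = ∀ m → coefficient m p R.≈ coefficient m q

  infixl 7 _*_

  _*_ : Polynomial → Polynomial → Polynomial
  _*_ = cartesianProductWith λ (a , u) (b , v) → a R.* b , u · v

  -_ : Polynomial → Polynomial
  -_ = map λ (a , u) → R.- a , u

  constant : Carrier → Polynomial
  constant a = (a , replicate n 0) ∷ []

  X : Fin n → Polynomial
  X i = (1# , replicate n 0 [ i ]≔ 1) ∷ []

  private
    open import Relation.Binary.Reasoning.Setoid R.setoid
    open CommutativeSemigroupProperties R.+-commutativeSemigroup using (interchange)
    open CommutativeSemigroupProperties R.*-commutativeSemigroup using (x∙yz≈y∙xz)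
    open RingProperties R.ring using (-‿distribˡ-*; -‿+-comm; -0#≈0#)

    linear-cong : ∀ {φ ψ} → (∀ u → φ u R.≈ ψ u) → ∀ p → linear φ p R.≈ linear ψ p
    linear-cong h []            = R.refl
    linear-cong h ((a , u) ∷ p) = R.+-cong (R.*-congˡ (h u)) (linear-cong h p)

    linear-++ : ∀ φ p q → linear φ (p ++ q) R.≈ linear φ p R.+ linear φ q
    linear-++ φ []            q = R.sym (R.+-identityˡ _)
    linear-++ φ ((a , u) ∷ p) q =
      R.trans (R.+-congˡ (linear-++ φ p q)) (R.sym (R.+-assoc _ _ _))

    linear-neg : ∀ φ p → linear φ (- p) R.≈ R.- linear φ p
    linear-neg φ []            = R.sym -0#≈0#
    linear-neg φ ((a , u) ∷ p) =
      R.trans (R.+-cong (R.sym (-‿distribˡ-* a (φ u))) (linear-neg φ p)) (-‿+-comm _ _)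

    linear-0 : ∀ p → linear (λ _ → 0#) p R.≈ 0#
    linear-0 []            = R.refl
    linear-0 ((a , u) ∷ p) =
      R.trans (R.+-cong (R.zeroʳ a) (linear-0 p)) (R.+-identityˡ 0#)

    linear-+ : ∀ φ ψ p → linear (λ u → φ u R.+ ψ u) p R.≈ linear φ p R.+ linear ψ p
    linear-+ φ ψ []            = R.sym (R.+-identityˡ 0#)
    linear-+ φ ψ ((a , u) ∷ p) =
      R.trans (R.+-cong (R.distribˡ a (φ u) (ψ u)) (linear-+ φ ψ p)) (interchange _ _ _ _)

    linear-* : ∀ b φ p → linear (λ u → b R.* φ u) p R.≈ b R.* linear φ p
    linear-* b φ []            = R.sym (R.zeroʳ b)
    linear-* b φ ((a , u) ∷ p) =
      R.trans (R.+-cong (x∙yz≈y∙xz a b (φ u)) (linear-* b φ p)) (R.sym (R.distribˡ b _ _))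

    linear-term : ∀ φ a u q →
      linear φ (map (λ (b , v) → a R.* b , u · v) q) R.≈ a R.* linear (λ v → φ (u · v)) q
    linear-term φ a u []            = R.sym (R.zeroʳ a)
    linear-term φ a u ((b , v) ∷ q) =
      R.trans (R.+-cong (R.*-assoc a b _) (linear-term φ a u q)) (R.sym (R.distribˡ a _ _))

    linear-product : ∀ φ p q →
      linear φ (p * q) R.≈ linear (λ u → linear (λ v → φ (u · v)) q) p
    linear-product φ []            q = R.refl
    linear-product φ ((a , u) ∷ p) q =
      R.trans (linear-++ φ (map _ q) (p * q))
        (R.+-cong (linear-term φ a u q) (linear-product φ p q))

    linear-swap : ∀ (F : Monomial → Monomial → Carrier) p q →
      linear (λ u → linear (F u) q) p R.≈ linear (λ v → linear (λ u → F u v) p) q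
    linear-swap F []            q = R.sym (linear-0 q)
    linear-swap F ((a , u) ∷ p) q = begin
      a R.* linear (F u) q R.+ linear (λ u → linear (F u) q) p
        ≈⟨ R.+-cong (R.sym (linear-* a (F u) q)) (linear-swap F p q) ⟩
      linear (λ v → a R.* F u v) q R.+ linear (λ v → linear (λ u → F u v) p) q
        ≈⟨ R.sym (linear-+ _ _ q) ⟩
      linear (λ v → a R.* F u v R.+ linear (λ u → F u v) p) q ∎

    ·-comm : ∀ u v → u · v ≡ v · u
    ·-comm = Vec.zipWith-comm ℕ.+-comm

    ·-cancel : ∀ {k} (u v : Vec ℕ k) → zipWith ℕ._∸_ (zipWith ℕ._+_ u v) u ≡ v
    ·-cancel []      []      = refl
    ·-cancel (i ∷ u) (j ∷ v) = cong₂ _∷_ (ℕ.m+n∸m≡n i j) (·-cancel u v)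

    δ-yes : ∀ m u → u ≡ m → δ m u ≡ 1#
    δ-yes m u eq = cong (if_then 1# else 0#) (dec-true (Vec.≡-dec ℕ._≟_ u m) eq)

    δ-no : ∀ m u → ¬ u ≡ m → δ m u ≡ 0#
    δ-no m u neq = cong (if_then 1# else 0#) (dec-false (Vec.≡-dec ℕ._≟_ u m) neq)

    shift-cong : ∀ m u {q r} → q ≈ r →
      linear (λ v → δ m (u · v)) q R.≈ linear (λ v → δ m (u · v)) r
    shift-cong m u {q} {r} q≈r with Vec.≡-dec ℕ._≟_ (u · zipWith ℕ._∸_ m u) m
    ... | yes u·w≡m = begin
      linear (λ v → δ m (u · v)) q  ≈⟨ linear-cong shifted q ⟩
      coefficient w q               ≈⟨ q≈r w ⟩
      coefficient w r               ≈⟨ linear-cong shifted r ⟨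
      linear (λ v → δ m (u · v)) r  ∎
      where
      w = zipWith ℕ._∸_ m u
      shifted : ∀ v → δ m (u · v) R.≈ δ w v
      shifted v with Vec.≡-dec ℕ._≟_ v w
      ... | yes v≡w = R.reflexive (δ-yes m (u · v) (≡.trans (cong (u ·_) v≡w) u·w≡m))
      ... | no  v≢w = R.reflexive (δ-no m (u · v) λ eq →
        v≢w (≡.trans (≡.sym (·-cancel u v)) (cong (λ z → zipWith ℕ._∸_ z u) eq)))
    ... | no u·w≢m = R.trans (vanishes q) (R.sym (vanishes r))
      where
      vanishes : ∀ q → linear (λ v → δ m (u · v)) q R.≈ 0#
      vanishes q = R.trans
        (linear-cong (λ v → R.reflexive (δ-no m (u · v) λ eq → u·w≢m
          (≡.trans (cong (u ·_) (≡.trans (cong (λ z → zipWith ℕ._∸_ z u) (≡.sym eq)) (·-cancel u v))) eq))) q)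
        (linear-0 q)

    infix 4 _≋_
    _≋_ : Polynomial → Polynomial → Set (c ⊔ ℓ)
    p ≋ q = ∀ φ → linear φ p R.≈ linear φ q

    ≋⇒≈ : ∀ p q → p ≋ q → p ≈ q
    ≋⇒≈ p q h m = h (δ m)

    ++-cong : ∀ {p q r s} → p ≈ q → r ≈ s → p ++ r ≈ q ++ s
    ++-cong {p} {q} {r} {s} h k m =
      R.trans (linear-++ _ p r) (R.trans (R.+-cong (h m) (k m)) (R.sym (linear-++ _ q s)))

    ++-comm : ∀ p q → p ++ q ≋ q ++ p
    ++-comm p q φ =
      R.trans (linear-++ φ p q) (R.trans (R.+-comm _ _) (R.sym (linear-++ φ q p)))

    ++-assoc : ∀ p q r → (p ++ q) ++ r ≋ p ++ (q ++ r)
    ++-assoc p q r φ = begin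
      linear φ ((p ++ q) ++ r)                        ≈⟨ linear-++ φ (p ++ q) r ⟩
      linear φ (p ++ q) R.+ linear φ r                ≈⟨ R.+-congʳ (linear-++ φ p q) ⟩
      linear φ p R.+ linear φ q R.+ linear φ r        ≈⟨ R.+-assoc _ _ _ ⟩
      linear φ p R.+ (linear φ q R.+ linear φ r)      ≈⟨ R.+-congˡ (linear-++ φ q r) ⟨
      linear φ p R.+ linear φ (q ++ r)                ≈⟨ linear-++ φ p (q ++ r) ⟨
      linear φ (p ++ (q ++ r))                        ∎

    neg-inverseˡ : ∀ p → - p ++ p ≋ []
    neg-inverseˡ p φ = R.trans (linear-++ φ (- p) p)
      (R.trans (R.+-congʳ (linear-neg φ p)) (R.-‿inverseˡ _))

    neg-cong : ∀ {p q} → p ≈ q → - p ≈ - q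
    neg-cong {p} {q} h m =
      R.trans (linear-neg _ p) (R.trans (R.-‿cong (h m)) (R.sym (linear-neg _ q)))

    *-comm : ∀ p q → p * q ≋ q * p
    *-comm p q φ = begin
      linear φ (p * q)                              ≈⟨ linear-product φ p q ⟩
      linear (λ u → linear (λ v → φ (u · v)) q) p   ≈⟨ linear-swap (λ u v → φ (u · v)) p q ⟩
      linear (λ v → linear (λ u → φ (u · v)) p) q
        ≈⟨ linear-cong (λ v → linear-cong (λ u → R.reflexive (cong φ (·-comm u v))) p) q ⟩
      linear (λ v → linear (λ u → φ (v · u)) p) q   ≈⟨ linear-product φ q p ⟨
      linear φ (q * p)                              ∎

    *-congˡ : ∀ p {q r} → q ≈ r → p * q ≈ p * r
    *-congˡ p {q} {r} q≈r m = begin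
      linear (δ m) (p * q)                             ≈⟨ linear-product (δ m) p q ⟩
      linear (λ u → linear (λ v → δ m (u · v)) q) p    ≈⟨ linear-cong (λ u → shift-cong m u {q} {r} q≈r) p ⟩
      linear (λ u → linear (λ v → δ m (u · v)) r) p    ≈⟨ linear-product (δ m) p r ⟨
      linear (δ m) (p * r)                             ∎

    *-cong : ∀ {p q r s} → p ≈ q → r ≈ s → p * r ≈ q * s
    *-cong {p} {q} {r} {s} h k m = begin
      linear (δ m) (p * r)  ≈⟨ *-congˡ p {r} {s} k m ⟩
      linear (δ m) (p * s)  ≈⟨ *-comm p s (δ m) ⟩
      linear (δ m) (s * p)  ≈⟨ *-congˡ s {p} {q} h m ⟩
      linear (δ m) (s * q)  ≈⟨ *-comm s q (δ m) ⟩
      linear (δ m) (q * s)  ∎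

    *-assoc : ∀ p q r → (p * q) * r ≋ p * (q * r)
    *-assoc p q r φ = begin
      linear φ ((p * q) * r)
        ≈⟨ linear-product φ (p * q) r ⟩
      linear (λ w → linear (λ t → φ (w · t)) r) (p * q)
        ≈⟨ linear-product _ p q ⟩
      linear (λ u → linear (λ v → linear (λ t → φ ((u · v) · t)) r) q) p
        ≈⟨ linear-cong (λ u → linear-cong (λ v → linear-cong (λ t →
             R.reflexive (cong φ (Vec.zipWith-assoc ℕ.+-assoc u v t))) r) q) p ⟩
      linear (λ u → linear (λ v → linear (λ t → φ (u · (v · t))) r) q) p
        ≈⟨ linear-cong (λ u → linear-product (λ w → φ (u · w)) q r) p ⟨
      linear (λ u → linear (λ w → φ (u · w)) (q * r)) p
        ≈⟨ linear-product φ p (q * r) ⟨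
      linear φ (p * (q * r)) ∎

    *-identityˡ : ∀ p → constant 1# * p ≋ p
    *-identityˡ p φ = begin
      linear φ (constant 1# * p)
        ≈⟨ linear-product φ (constant 1#) p ⟩
      1# R.* linear (λ v → φ (replicate n 0 · v)) p R.+ 0#
        ≈⟨ R.trans (R.+-identityʳ _) (R.*-identityˡ _) ⟩
      linear (λ v → φ (replicate n 0 · v)) p
        ≈⟨ linear-cong (λ v → R.reflexive (cong φ (Vec.zipWith-identityˡ ℕ.+-identityˡ v))) p ⟩
      linear φ p ∎

    *-distribʳ : ∀ p q r → (q ++ r) * p ≋ q * p ++ r * p
    *-distribʳ p q r φ = begin
      linear φ ((q ++ r) * p)                   ≈⟨ linear-product φ (q ++ r) p ⟩
      linear ψ′ (q ++ r)                        ≈⟨ linear-++ ψ′ q r ⟩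
      linear ψ′ q R.+ linear ψ′ r               ≈⟨ R.+-cong (linear-product φ q p) (linear-product φ r p) ⟨
      linear φ (q * p) R.+ linear φ (r * p)     ≈⟨ linear-++ φ (q * p) (r * p) ⟨
      linear φ (q * p ++ r * p)                 ∎
      where ψ′ = λ u → linear (λ v → φ (u · v)) p

    *-distribˡ : ∀ p q r → p * (q ++ r) ≋ p * q ++ p * r
    *-distribˡ p q r φ = begin
      linear φ (p * (q ++ r))                   ≈⟨ *-comm p (q ++ r) φ ⟩
      linear φ ((q ++ r) * p)                   ≈⟨ *-distribʳ p q r φ ⟩
      linear φ (q * p ++ r * p)                 ≈⟨ linear-++ φ (q * p) (r * p) ⟩
      linear φ (q * p) R.+ linear φ (r * p)     ≈⟨ R.+-cong (*-comm q p φ) (*-comm r p φ) ⟩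
      linear φ (p * q) R.+ linear φ (p * r)     ≈⟨ linear-++ φ (p * q) (p * r) ⟨
      linear φ (p * q ++ p * r)                 ∎

    isCommutativeRing : IsCommutativeRing _≈_ _++_ _*_ -_ [] (constant 1#)
    isCommutativeRing = record
      { isRing = record
        { +-isAbelianGroup = record
          { isGroup = record
            { isMonoid = record
              { isSemigroup = record
                { isMagma = record
                  { isEquivalence = record
                    { refl  = λ _ → R.refl
                    ; sym   = λ h m → R.sym (h m)
                    ; trans = λ h k m → R.trans (h m) (k m)
                    }
                  ; ∙-cong = λ {p} {q} {r} {s} → ++-cong {p} {q} {r} {s}
                  }
                ; assoc = λ p q r → ≋⇒≈ ((p ++ q) ++ r) (p ++ (q ++ r)) (++-assoc p q r)
                }
              ; identity = (λ p _ → R.refl) , λ p → ≋⇒≈ (p ++ []) p (++-comm p [])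
              }
            ; inverse = (λ p → ≋⇒≈ (- p ++ p) [] (neg-inverseˡ p)) ,
                (λ p → ≋⇒≈ (p ++ - p) [] λ φ →
                  R.trans (++-comm p (- p) φ) (neg-inverseˡ p φ))
            ; ⁻¹-cong = λ {p} {q} → neg-cong {p} {q}
            }
          ; comm = λ p q → ≋⇒≈ (p ++ q) (q ++ p) (++-comm p q)
          }
        ; *-cong = λ {p} {q} {r} {s} → *-cong {p} {q} {r} {s}
        ; *-assoc = λ p q r → ≋⇒≈ ((p * q) * r) (p * (q * r)) (*-assoc p q r)
        ; *-identity =
            (λ p → ≋⇒≈ (constant 1# * p) p (*-identityˡ p)) ,
            (λ p → ≋⇒≈ (p * constant 1#) p λ φ →
              R.trans (*-comm p (constant 1#) φ) (*-identityˡ p φ))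
        ; distrib =
            (λ p q r → ≋⇒≈ (p * (q ++ r)) (p * q ++ p * r) (*-distribˡ p q r)) ,
            (λ p q r → ≋⇒≈ ((q ++ r) * p) (q * p ++ r * p) (*-distribʳ p q r))
        }
      ; *-comm = λ p q → ≋⇒≈ (p * q) (q * p) (*-comm p q)
      }

  commutativeRing : CommutativeRing c ℓ
  commutativeRing = record { isCommutativeRing = isCommutativeRing }

combinations : ∀ {a} {A : Set a} → ℕ → List A → List (List A)
combinations zero    _        = [] ∷ []
combinations (suc k) []       = []
combinations (suc k) (x ∷ xs) = map (x ∷_) (combinations k xs) ++ combinations (suc k) xs

module RingNotions (R : CommutativeRing c ℓ) where
  open CommutativeRing R using (Carrier; _+_; _*_; _-_; 0#; 1#)

  -- The right fold of _-_ is the alternating sum a₀ - (a₁ - (a₂ - ⋯)), so this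
  -- is the Laplace expansion along row 0.
  det : ∀ {n} → (Fin n → Fin n → Carrier) → Carrier
  det {zero}  M = 1#
  det {suc n} M = Vector.foldr _-_ 0# λ j → M zero j * det λ i k → M (suc i) (punchIn j k)

  -- The degree k elementary symmetric function.
  σ : ℕ → List Carrier → Carrier
  σ k = foldr _+_ 0# ∘ map (foldr _*_ 1#) ∘ combinations k

  -- 𝒞 x_a x_b x_c x_d x_e x_f is the 𝒞_{ab,cd,ef} of the variables x.
  𝒞 : (xa xb xc xd xe xf : Carrier) → Carrier
  𝒞 xa xb xc xd xe xf = det λ i → lookup (lookup rows i)
    where
    rows : Vec (Vec Carrier 3) 3
    rows = (1#       ∷ 1#       ∷ 1#       ∷ [])
         ∷ (xa + xb  ∷ xc + xd  ∷ xe + xf  ∷ [])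
         ∷ (xa * xb  ∷ xc * xd  ∷ xe * xf  ∷ [])
         ∷ []

-- Opaque only so that comparing two polynomial expressions does not normalise
-- them to lists of terms.
opaque
  ℂ[x₁,…,x₆] : CommutativeRing 0ℓ 0ℓ
  ℂ[x₁,…,x₆] = MultivariatePolynomial.commutativeRing ℂ 6

  x₁ x₂ x₃ x₄ x₅ x₆ : CommutativeRing.Carrier ℂ[x₁,…,x₆]
  x₁ = MultivariatePolynomial.X ℂ 6 0F
  x₂ = MultivariatePolynomial.X ℂ 6 1F
  x₃ = MultivariatePolynomial.X ℂ 6 2F
  x₄ = MultivariatePolynomial.X ℂ 6 3F
  x₅ = MultivariatePolynomial.X ℂ 6 4F
  x₆ = MultivariatePolynomial.X ℂ 6 5F

open CommutativeRing ℂ[x₁,…,x₆] public using (_≈_; _+_; _*_; _-_; -_; 0#)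
open RingNotions ℂ[x₁,…,x₆] public using (𝒞; σ)

{-# OPTIONS --safe #-}

-- With s = σ₁, the cubic is a sum of two products of three linear forms:
--   5σ₁³ - 18σ₁σ₂ + 27σ₃ = (s - 3f₁)(s - 3f₂)(s - 3(f₁ + f₂))
--                          + (s - 3(f₃ + f₄))(s - 3(f₃ + f₅))(s - 3(f₄ + f₅)).
-- Each of the six forms is three times a product of differences xᵢ - xⱼ over a
-- perfect matching of {1,…,6}.  The three matchings of either product together
-- make up the same nine edges, a hexagon and its three long diagonals, and the
-- orientations of these edges give the two products opposite signs.
module Submission where

import Defs
open import Algebra.Bundles using (CommutativeRing)
open import Data.List.Base using (List; []; _∷_; foldr; map)

import Algebra.Properties.AbelianGroup as AbelianGroupProperties
import Algebra.Properties.Ring as RingProperties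
import Algebra.Properties.Semiring.Exp as Exponentiation
import Algebra.Properties.Semiring.Mult as Multiplication
import Algebra.Properties.Semiring.Mult.TCOptimised as OptimisedMultiplication
import Algebra.Solver.Ring
open import Algebra.Solver.Ring.AlmostCommutativeRing
  using (fromCommutativeRing; _-Raw-AlmostCommutative⟶_)
open import Data.Fin.Base using (Fin; zero; suc; punchIn)
open import Data.Fin.Patterns using (0F; 1F; 2F; 3F; 4F; 5F)
open import Data.Integer.Base as ℤ using (ℤ; +_; -[1+_]; 0ℤ; 1ℤ)
import Data.Integer.Properties as ℤ
open import Data.Maybe.Base as Maybe using (Maybe)
open import Data.Nat.Base as ℕ using (ℕ; zero; suc)
open import Data.Vec.Base using (Vec; []; _∷_; lookup)
import Data.Vec.Functional as Vector
open import Function.Base using (_∘_)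
import Relation.Binary.PropositionalEquality as ≡
open import Relation.Nullary.Decidable using (dec⇒maybe)

-- Equality in `R` need not be decidable, so the solver computes with coefficients in ℤ, carried to
-- `R` by the canonical homomorphism.
module IntegerCoefficients {c ℓ} (R : CommutativeRing c ℓ) where
  open CommutativeRing R hiding (zero)
  open AbelianGroupProperties +-abelianGroup using (⁻¹-involutive; ⁻¹-∙-comm; ε⁻¹≈ε)
  open RingProperties ring using (-‿distribˡ-*)
  open OptimisedMultiplication semiring using (1+×; ×-homo-+; ×1-homo-*)
    renaming (_×_ to _×′_)
  open import Algebra.Properties.CommutativeSemigroup +-commutativeSemigroup using (interchange)
  open import Relation.Binary.Reasoning.Setoid setoid

  -- With this multiplication ⟦ 1ℤ ⟧ᶻ is 1# definitionally, so that con 1ℤ below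
  -- evaluates to the entry 1# of a determinant.
  ⟦_⟧ᶻ : ℤ → Carrier
  ⟦ + n      ⟧ᶻ = n ×′ 1#
  ⟦ -[1+ n ] ⟧ᶻ = - (suc n ×′ 1#)

  ⊖-homo : ∀ m n → ⟦ m ℤ.⊖ n ⟧ᶻ ≈ m ×′ 1# - n ×′ 1#
  ⊖-homo m       zero    = sym (trans (+-congˡ ε⁻¹≈ε) (+-identityʳ _))
  ⊖-homo zero    (suc n) = sym (+-identityˡ _)
  ⊖-homo (suc m) (suc n) = begin
    ⟦ suc m ℤ.⊖ suc n ⟧ᶻ                ≡⟨ ≡.cong ⟦_⟧ᶻ (ℤ.[1+m]⊖[1+n]≡m⊖n m n) ⟩
    ⟦ m ℤ.⊖ n ⟧ᶻ                        ≈⟨ ⊖-homo m n ⟩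
    m ×′ 1# - n ×′ 1#                   ≈⟨ +-identityˡ _ ⟨
    -- Writing `0#` as `1# - 1#` lets `interchange` give one more `1#` to each multiple.
    0# + (m ×′ 1# - n ×′ 1#)            ≈⟨ +-congʳ (-‿inverseʳ 1#) ⟨
    (1# - 1#) + (m ×′ 1# - n ×′ 1#)     ≈⟨ interchange _ _ _ _ ⟩
    (1# + m ×′ 1#) + (- 1# - n ×′ 1#)   ≈⟨ +-congˡ (⁻¹-∙-comm _ _) ⟩
    (1# + m ×′ 1#) - (1# + n ×′ 1#)     ≈⟨ +-cong (1+× m 1#) (-‿cong (1+× n 1#)) ⟨
    suc m ×′ 1# - suc n ×′ 1#           ∎

  -‿homo : ∀ i → ⟦ ℤ.- i ⟧ᶻ ≈ - ⟦ i ⟧ᶻ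
  -‿homo (+ zero)   = sym ε⁻¹≈ε
  -‿homo (+ suc n)  = refl
  -‿homo (-[1+ n ]) = sym (⁻¹-involutive _)

  +-homo : ∀ i j → ⟦ i ℤ.+ j ⟧ᶻ ≈ ⟦ i ⟧ᶻ + ⟦ j ⟧ᶻ
  +-homo (+ m)      (+ n)      = ×-homo-+ 1# m n
  +-homo (+ m)      (-[1+ n ]) = ⊖-homo m (suc n)
  +-homo (-[1+ m ]) (+ n)      = trans (⊖-homo n (suc m)) (+-comm _ _)
  +-homo (-[1+ m ]) (-[1+ n ]) = begin
    ⟦ -[1+ suc (m ℕ.+ n) ] ⟧ᶻ           ≡⟨ ≡.cong ⟦_⟧ᶻ (ℤ.neg-distrib-+ (+ suc m) (+ suc n)) ⟨
    ⟦ ℤ.- (+ suc m ℤ.+ + suc n) ⟧ᶻ      ≈⟨ -‿cong (×-homo-+ 1# (suc m) (suc n)) ⟩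
    - (suc m ×′ 1# + suc n ×′ 1#)       ≈⟨ ⁻¹-∙-comm _ _ ⟨
    - (suc m ×′ 1#) - suc n ×′ 1#       ∎

  -- Fixing the pair lets multiplicativity be carried along negation and exchange of factors, which
  -- reduces all sign cases to two nonnegative factors.
  MultiplicativeAt : ℤ → ℤ → Set ℓ
  MultiplicativeAt i j = ⟦ i ℤ.* j ⟧ᶻ ≈ ⟦ i ⟧ᶻ * ⟦ j ⟧ᶻ

  multiplicativeAt-sym : ∀ i j → MultiplicativeAt i j → MultiplicativeAt j i
  multiplicativeAt-sym i j h =
    trans (reflexive (≡.cong ⟦_⟧ᶻ (ℤ.*-comm j i))) (trans h (*-comm _ _))

  multiplicativeAt-neg : ∀ i j → MultiplicativeAt i j → MultiplicativeAt (ℤ.- i) j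
  multiplicativeAt-neg i j h = begin
    ⟦ ℤ.- i ℤ.* j ⟧ᶻ      ≡⟨ ≡.cong ⟦_⟧ᶻ (ℤ.neg-distribˡ-* i j) ⟨
    ⟦ ℤ.- (i ℤ.* j) ⟧ᶻ    ≈⟨ -‿homo (i ℤ.* j) ⟩
    - ⟦ i ℤ.* j ⟧ᶻ        ≈⟨ -‿cong h ⟩
    - (⟦ i ⟧ᶻ * ⟦ j ⟧ᶻ)   ≈⟨ -‿distribˡ-* _ _ ⟩
    - ⟦ i ⟧ᶻ * ⟦ j ⟧ᶻ     ≈⟨ *-congʳ (-‿homo i) ⟨
    ⟦ ℤ.- i ⟧ᶻ * ⟦ j ⟧ᶻ   ∎

  *-homo-+ : ∀ i n → MultiplicativeAt i (+ n)
  *-homo-+ (+ m)      n =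
    trans (reflexive (≡.cong ⟦_⟧ᶻ (≡.sym (ℤ.pos-* m n)))) (×1-homo-* m n)
  *-homo-+ (-[1+ m ]) n = multiplicativeAt-neg (+ suc m) (+ n) (*-homo-+ (+ suc m) n)

  *-homo : ∀ i j → MultiplicativeAt i j
  *-homo i (+ n)      = *-homo-+ i n
  *-homo i (-[1+ n ]) = multiplicativeAt-sym -[1+ n ] i
    (multiplicativeAt-neg (+ suc n) i (multiplicativeAt-sym i (+ suc n) (*-homo-+ i (suc n))))

  morphism : ℤ.+-*-rawRing -Raw-AlmostCommutative⟶ fromCommutativeRing R
  morphism = record
    { ⟦_⟧    = ⟦_⟧ᶻ
    ; +-homo = +-homo
    ; *-homo = *-homo
    ; -‿homo = -‿homo
    ; 0-homo = refl
    ; 1-homo = refl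
    }

  -- Only equality is certified: distinct integers can have equal images in positive characteristic.
  _≟ᶻ_ : ∀ i j → Maybe (⟦ i ⟧ᶻ ≈ ⟦ j ⟧ᶻ)
  i ≟ᶻ j = Maybe.map (reflexive ∘ ≡.cong ⟦_⟧ᶻ) (dec⇒maybe (i ℤ.≟ j))

  open Algebra.Solver.Ring ℤ.+-*-rawRing (fromCommutativeRing R) morphism _≟ᶻ_ public

module Relation {c ℓ} (R : CommutativeRing c ℓ) where
  open CommutativeRing R hiding (zero)
  open Defs using (combinations)
  open Defs.RingNotions R
  open Multiplication semiring using (_×_)
  open Exponentiation semiring using (_^_)
  open IntegerCoefficients R

  -- The solver works on syntax, so det, σ and 𝒞 are mirrored, operation for
  -- operation, such that evaluating the mirror images gives back the originals.
  private
    detˢ : ∀ {k n} → (Fin n → Fin n → Polynomial k) → Polynomial k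
    detˢ {n = zero}  M = con 1ℤ
    detˢ {n = suc n} M =
      Vector.foldr _:-_ (con 0ℤ) λ j → M zero j :* detˢ λ i k → M (suc i) (punchIn j k)

    σˢ : ∀ {k} → ℕ → List (Polynomial k) → Polynomial k
    σˢ k = foldr _:+_ (con 0ℤ) ∘ map (foldr _:*_ (con 1ℤ)) ∘ combinations k

    𝒞ˢ : ∀ {k} (a b c d e f : Polynomial k) → Polynomial k
    𝒞ˢ {k} a b c d e f = detˢ λ i → lookup (lookup rows i)
      where
      rows : Vec (Vec (Polynomial k) 3) 3
      rows = (con 1ℤ ∷ con 1ℤ ∷ con 1ℤ ∷ [])
           ∷ (a :+ b ∷ c :+ d ∷ e :+ f ∷ [])
           ∷ (a :* b ∷ c :* d ∷ e :* f ∷ [])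
           ∷ []

  -- With u = s - 3(f₃ + f₄ + f₅), the second product is (u + 3f₅)(u + 3f₄)(u + 3f₃). Keeping the fᵢ
  -- as free variables means expanding in degree 3; with the determinants substituted the degree
  -- would be 9.
  cubic-splits : ∀ f₁ f₂ f₃ f₄ f₅ →
    let f = f₁ ∷ f₂ ∷ f₃ ∷ f₄ ∷ f₅ ∷ []
        s = f₁ + f₂ + f₃ + f₄ + f₅
    in 5 × (σ 1 f ^ 3) - 18 × (σ 1 f * σ 2 f) + 27 × σ 3 f ≈
       (s - 3 × f₁) * (s - 3 × f₂) * (s - 3 × (f₁ + f₂)) +
       (s - 3 × (f₃ + f₄)) * (s - 3 × (f₃ + f₅)) * (s - 3 × (f₄ + f₅))
  cubic-splits = solve 5 (λ f₁ f₂ f₃ f₄ f₅ →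
    let f = f₁ ∷ f₂ ∷ f₃ ∷ f₄ ∷ f₅ ∷ []
        s = f₁ :+ f₂ :+ f₃ :+ f₄ :+ f₅
    in 5 :× (σˢ 1 f :^ 3) :- 18 :× (σˢ 1 f :* σˢ 2 f) :+ 27 :× σˢ 3 f :=
       (s :- 3 :× f₁) :* (s :- 3 :× f₂) :* (s :- 3 :× (f₁ :+ f₂)) :+
       (s :- 3 :× (f₃ :+ f₄)) :* (s :- 3 :× (f₃ :+ f₅)) :* (s :- 3 :× (f₄ :+ f₅))) refl

  -- Each of the nine edges, `e` for sides and `d` for long diagonals, is a factor of either product
  -- exactly once; the single negation makes the products opposite.
  hexagon-cancels : ∀ e₁₂ e₂₃ e₃₄ e₄₅ e₅₆ e₆₁ d₁₄ d₂₅ d₃₆ →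
    (3 × (e₁₂ * e₃₄ * e₅₆)) * (3 × (e₂₃ * e₄₅ * e₆₁)) * (3 × (d₁₄ * d₂₅ * d₃₆)) +
    (3 × (d₂₅ * e₃₄ * e₆₁)) * (3 × (d₃₆ * e₄₅ * e₁₂)) * (3 × (d₁₄ * e₂₃ * - e₅₆)) ≈ 0#
  hexagon-cancels = solve 9 (λ e₁₂ e₂₃ e₃₄ e₄₅ e₅₆ e₆₁ d₁₄ d₂₅ d₃₆ →
    (3 :× (e₁₂ :* e₃₄ :* e₅₆)) :* (3 :× (e₂₃ :* e₄₅ :* e₆₁)) :* (3 :× (d₁₄ :* d₂₅ :* d₃₆)) :+
    (3 :× (d₂₅ :* e₃₄ :* e₆₁)) :* (3 :× (d₃₆ :* e₄₅ :* e₁₂)) :* (3 :× (d₁₄ :* e₂₃ :* :- e₅₆)) :=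
    con 0ℤ) refl

  module Forms (x₁ x₂ x₃ x₄ x₅ x₆ : Carrier) where
    f₁ f₂ f₃ f₄ f₅ s : Carrier
    f₁ = 𝒞 x₁ x₂ x₃ x₄ x₅ x₆
    f₂ = - 𝒞 x₁ x₆ x₂ x₃ x₄ x₅
    f₃ = 𝒞 x₁ x₄ x₂ x₆ x₃ x₅
    f₄ = - 𝒞 x₁ x₅ x₂ x₄ x₃ x₆
    f₅ = 𝒞 x₁ x₃ x₂ x₅ x₄ x₆
    s  = f₁ + f₂ + f₃ + f₄ + f₅

    private
      ρ : Vec Carrier 6
      ρ = x₁ ∷ x₂ ∷ x₃ ∷ x₄ ∷ x₅ ∷ x₆ ∷ []

      y₁ y₂ y₃ y₄ y₅ y₆ g₁ g₂ g₃ g₄ g₅ t : Polynomial 6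
      y₁ = var 0F
      y₂ = var 1F
      y₃ = var 2F
      y₄ = var 3F
      y₅ = var 4F
      y₆ = var 5F
      g₁ = 𝒞ˢ y₁ y₂ y₃ y₄ y₅ y₆
      g₂ = :- 𝒞ˢ y₁ y₆ y₂ y₃ y₄ y₅
      g₃ = 𝒞ˢ y₁ y₄ y₂ y₆ y₃ y₅
      g₄ = :- 𝒞ˢ y₁ y₅ y₂ y₄ y₃ y₆
      g₅ = 𝒞ˢ y₁ y₃ y₂ y₅ y₄ y₆
      t  = g₁ :+ g₂ :+ g₃ :+ g₄ :+ g₅

    -- The matching on the right is the one that indexes `f₁`; the same holds for `f₂` below.
    s-3f₁ : s - 3 × f₁ ≈ 3 × ((x₂ - x₁) * (x₃ - x₄) * (x₅ - x₆))
    s-3f₁ = prove ρ (t :- 3 :× g₁) (3 :× ((y₂ :- y₁) :* (y₃ :- y₄) :* (y₅ :- y₆))) refl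

    s-3f₂ : s - 3 × f₂ ≈ 3 × ((x₂ - x₃) * (x₄ - x₅) * (x₆ - x₁))
    s-3f₂ = prove ρ (t :- 3 :× g₂) (3 :× ((y₂ :- y₃) :* (y₄ :- y₅) :* (y₆ :- y₁))) refl

    -- For a sum of two forms, the matching takes one edge from the matching of each of the other
    -- three.
    s-3f₁₂ : s - 3 × (f₁ + f₂) ≈ 3 × ((x₁ - x₄) * (x₂ - x₅) * (x₃ - x₆))
    s-3f₁₂ = prove ρ (t :- 3 :× (g₁ :+ g₂)) (3 :× ((y₁ :- y₄) :* (y₂ :- y₅) :* (y₃ :- y₆))) refl

    s-3f₃₄ : s - 3 × (f₃ + f₄) ≈ 3 × ((x₂ - x₅) * (x₃ - x₄) * (x₆ - x₁))
    s-3f₃₄ = prove ρ (t :- 3 :× (g₃ :+ g₄)) (3 :× ((y₂ :- y₅) :* (y₃ :- y₄) :* (y₆ :- y₁))) refl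

    s-3f₃₅ : s - 3 × (f₃ + f₅) ≈ 3 × ((x₃ - x₆) * (x₄ - x₅) * (x₂ - x₁))
    s-3f₃₅ = prove ρ (t :- 3 :× (g₃ :+ g₅)) (3 :× ((y₃ :- y₆) :* (y₄ :- y₅) :* (y₂ :- y₁))) refl

    -- The reversed edge is written as a negation to fit the last factor of `hexagon-cancels`.
    s-3f₄₅ : s - 3 × (f₄ + f₅) ≈ 3 × ((x₁ - x₄) * (x₂ - x₃) * - (x₅ - x₆))
    s-3f₄₅ = prove ρ (t :- 3 :× (g₄ :+ g₅)) (3 :× ((y₁ :- y₄) :* (y₂ :- y₃) :* :- (y₅ :- y₆))) refl

    cubic≈0 :
      let f = f₁ ∷ f₂ ∷ f₃ ∷ f₄ ∷ f₅ ∷ []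
      in 5 × (σ 1 f ^ 3) - 18 × (σ 1 f * σ 2 f) + 27 × σ 3 f ≈ 0#
    cubic≈0 = trans (cubic-splits f₁ f₂ f₃ f₄ f₅)
      (trans (+-cong (*-cong (*-cong s-3f₁ s-3f₂) s-3f₁₂) (*-cong (*-cong s-3f₃₄ s-3f₃₅) s-3f₄₅))
             -- The first side is oriented as `x₂ - x₁`, against the order of its indices, because
             -- both forms containing it have this sign.
             (hexagon-cancels (x₂ - x₁) (x₂ - x₃) (x₃ - x₄) (x₄ - x₅) (x₅ - x₆) (x₆ - x₁)
                (x₁ - x₄) (x₂ - x₅) (x₃ - x₆)))

open Defs
open import Algebra.Properties.Semiring.Mult (CommutativeRing.semiring ℂ[x₁,…,x₆]) using (_×_)
open import Algebra.Properties.Semiring.Exp (CommutativeRing.semiring ℂ[x₁,…,x₆]) using (_^_)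

theorem10 :
  let f = 𝒞 x₁ x₂ x₃ x₄ x₅ x₆
        ∷ - 𝒞 x₁ x₆ x₂ x₃ x₄ x₅
        ∷ 𝒞 x₁ x₄ x₂ x₆ x₃ x₅
        ∷ - 𝒞 x₁ x₅ x₂ x₄ x₃ x₆
        ∷ 𝒞 x₁ x₃ x₂ x₅ x₄ x₆
        ∷ []
      σ₁ = σ 1 f
      σ₂ = σ 2 f
      σ₃ = σ 3 f
  in 5 × (σ₁ ^ 3) - 18 × (σ₁ * σ₂) + 27 × σ₃ ≈ 0#
theorem10 = Relation.Forms.cubic≈0 ℂ[x₁,…,x₆] x₁ x₂ x₃ x₄ x₅ x₆
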